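{- Let $k\geq 1$ be an integer and let $u,v$ be two factors of the Cantor sequence $\mathbf{c}$ with $|u|=|v|$. If $\mathrm{pref}_{k}(u)=\mathrm{pref}_{k}(v)$ and $\mathrm{suff}_{k}(u)=\mathrm{suff}_{k}(v)$, then $u\sim_{k+1}v$ if and only if $u\sim_{1}v$.
   Context: The Cantor sequence $\mathbf{c}=c_0c_1c_2\cdots\in\{0,1\}^{\mathbb N}$ is defined by $c_0=1$ and $c_{3n}=c_{3n+2}=c_n$, $c_{3n+1}=0$ for all $n\geq 0$ (so $\mathbf c=101000101000000000101000101\cdots$). A factor of $\mathbf c$ is a finite word of the form $c_ic_{i+1}\cdots c_{i+m-1}$. For a word $u=u_0\cdots u_{n-1}$ and $\ell\geq1$, $\mathrm{pref}_\ell(u)=u_0\cdots u_{\ell-1}$ and $\mathrm{suff}_\ell(u)=u_{n-\ell}\cdots u_{n-1}$; for $\ell\le 0$ both are the empty word. $|u|$ is the length of $u$ and $|u|_w$ the number of occurrences of the word $w$ as a factor of $u$. For an integer $k\geq1$, two words $u,v$ are $k$-abelian equivalent, written $u\sim_k v$, if $\mathrm{pref}_{k-1}(u)=\mathrm{pref}_{k-1}(v)$, $\mathrm{suff}_{k-1}(u)=\mathrm{suff}_{k-1}(v)$ and $|u|_w=|v|_w$ for every word $w$ of length $k$ over the alphabet. (Thus $u\sim_1 v$ means $u,v$ contain each letter the same number of times.) -}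

module Defs where

open import Data.Nat using (ℕ; zero; suc; _+_; _∸_)
open import Data.Nat.DivMod using (_/_; _%_)
open import Data.Bool using (Bool; true; false; if_then_else_)
open import Data.List using (List; []; _∷_; length; take; drop; reverse)
open import Data.Product using (Σ; _×_)
open import Relation.Binary.PropositionalEquality using (_≡_)
open import Data.Bool.Properties using (_≟_)
open import Relation.Nullary.Decidable using (does)

-- Cantor sequence via its defining recurrence
--   c 0 = 1, c (3n) = c (3n+2) = c n, c (3n+1) = 0.
-- Implemented with a fuel argument (fuel ≥ n+1 suffices since n / 3 < n for n ≥ 1).
cantorAux : ℕ → ℕ → Bool
cantorAux zero    _       = true   -- never reached when fuel ≥ n + 1
cantorAux (suc f) zero    = true
cantorAux (suc f) (suc m) with (suc m) % 3
... | 1 = false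
... | _ = cantorAux f ((suc m) / 3)

cantor : ℕ → Bool
cantor n = cantorAux (suc n) n

factorAt : ℕ → ℕ → List Bool
factorAt i zero    = []
factorAt i (suc m) = cantor i ∷ factorAt (suc i) m

IsFactor : List Bool → Set
IsFactor u = Σ ℕ λ i → u ≡ factorAt i (length u)

pref : ℕ → List Bool → List Bool
pref ℓ u = take ℓ u

suff : ℕ → List Bool → List Bool
suff ℓ u = drop (length u ∸ ℓ) u

isPrefix : List Bool → List Bool → Bool
isPrefix []       _        = true
isPrefix (_ ∷ _)  []       = false
isPrefix (a ∷ w)  (b ∷ u)  = does (a ≟ b) Data.Bool.∧ isPrefix w u

occ : List Bool → List Bool → ℕ
occ w []        = if isPrefix w [] then 1 else 0
occ w (a ∷ u)   = (if isPrefix w (a ∷ u) then 1 else 0) + occ w u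

_∼[_]_ : List Bool → ℕ → List Bool → Set
u ∼[ k ] v =
  (pref (k ∸ 1) u ≡ pref (k ∸ 1) v) ×
  (suff (k ∸ 1) u ≡ suff (k ∸ 1) v) ×
  ((w : List Bool) → length w ≡ k → occ w u ≡ occ w v)

{-# OPTIONS --safe #-}
module Submission where

-- Occurrence counts of words of length n + 2 are constrained by those of length n + 1 through one-letter
-- extensions on either side, the corrections being read off prefix and suffix.  For fixed w these relations
-- between the four numbers |u|_{awb} leave one degree of freedom, so u and v can only start to differ
-- at some w all of whose extensions awb are factors of c.  Undoing the substitution 1 ↦ 101, 0 ↦ 000
-- shows that such a w is 0^n with n = 3^m.
--
-- For this w the occurrences of 00^n1 and 10^n1 alternate along c, so the difference of their numbers in u is
-- a difference of states at the two ends of u, while their sum is already known.  Two ends showing the same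
-- window of length n + 1 have the same state unless their positions differ by n modulo 3n; as |u| = |v|,
-- lengths modulo 3n and the parity of the sum rule out every case in which the numbers of 10^n1 differ.

open import Defs
open import Data.Nat using (ℕ; zero; suc; _+_; _*_; _∸_; _≤_; _<_; _≥_; z≤n; s≤s; s≤s⁻¹)
open import Data.Nat.Properties hiding (_≟_)
open import Data.Nat.DivMod using (m<n⇒m/n≡0; _/_; _%_; m*n/n≡m; m/n<m; +-distrib-/-∣ʳ; [m+kn]%n≡m%n; m*n%n≡0)
open import Data.Nat.Divisibility using (n∣m*n)
open import Data.Bool using (Bool; true; false; if_then_else_; not; _∧_; _∨_)
open import Data.Bool.Properties using (_≟_; ∧-zeroʳ)
open import Data.List using (List; []; _∷_; length; take; drop; replicate; _∷ʳ_; initLast; _∷ʳ′_)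
open import Data.List.Properties
  using (≡-dec; ∷-injectiveˡ; ∷-injectiveʳ; length-++; length-replicate; take-take; drop-drop; drop-all)
open import Data.Product using (∃-syntax; _×_; _,_; proj₁; proj₂)
open import Data.Sum using (_⊎_; inj₁; inj₂)
open import Data.Empty using (⊥; ⊥-elim)
open import Relation.Nullary using (yes; no)
open import Relation.Nullary.Decidable using (does; dec-false)
open import Relation.Binary.PropositionalEquality
open import Data.Nat.Tactic.RingSolver using (solve-∀)
open import Function.Bundles using (_⇔_; mk⇔)

-- Recurrences of the Cantor sequence.

+q*3/3 : ∀ r q → (r + q * 3) / 3 ≡ r / 3 + q
+q*3/3 r q = trans (+-distrib-/-∣ʳ r (n∣m*n q)) (cong (r / 3 +_) (m*n/n≡m q 3))

-- The recursive call inside `cantor n` keeps n units of fuel, whereas `cantor (n / 3)` starts with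
-- n / 3 + 1; the recurrences below have to bridge the two.
cantorAux-fuel : ∀ f g n → n < f → n < g → cantorAux f n ≡ cantorAux g n
cantorAux-fuel (suc f) (suc g) zero _ _ = refl
cantorAux-fuel (suc f) (suc g) (suc m) (s≤s m<f) (s≤s m<g) with suc m % 3
... | 1 = refl
... | 0 = cantorAux-fuel f g (suc m / 3) (<-≤-trans n/3<n m<f) (<-≤-trans n/3<n m<g)
  where n/3<n = m/n<m (suc m) 3 (s≤s (s≤s z≤n))
... | suc (suc _) = cantorAux-fuel f g (suc m / 3) (<-≤-trans n/3<n m<f) (<-≤-trans n/3<n m<g)
  where n/3<n = m/n<m (suc m) 3 (s≤s (s≤s z≤n))

cantor-1 : ∀ q → cantor (1 + q * 3) ≡ false
cantor-1 q with suc (q * 3) % 3 | [m+kn]%n≡m%n 1 q 3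
... | _ | refl = refl

cantor-0 : ∀ q → cantor (q * 3) ≡ cantor q
cantor-0 zero = refl
cantor-0 (suc q) with (3 + q * 3) % 3 | [m+kn]%n≡m%n 3 q 3
... | _ | refl =
  trans (cong (cantorAux (3 + q * 3)) (+q*3/3 3 q))
        (cantorAux-fuel _ _ (suc q) (s≤s (s≤s (m≤n⇒m≤1+n (m≤m*n q 3)))) ≤-refl)

cantor-2 : ∀ q → cantor (2 + q * 3) ≡ cantor q
cantor-2 q with (2 + q * 3) % 3 | [m+kn]%n≡m%n 2 q 3
... | _ | refl =
  trans (cong (cantorAux (2 + q * 3)) (+q*3/3 2 q))
        (cantorAux-fuel _ _ q (s≤s (m≤n⇒m≤1+n (m≤m*n q 3))) ≤-refl)

-- Residues modulo 3.

data Mod3 : ℕ → Set where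
  0mod3 : ∀ q → Mod3 (q * 3)
  1mod3 : ∀ q → Mod3 (1 + q * 3)
  2mod3 : ∀ q → Mod3 (2 + q * 3)

mod3 : ∀ n → Mod3 n
mod3 0 = 0mod3 0
mod3 1 = 1mod3 0
mod3 2 = 2mod3 0
mod3 (suc (suc (suc n))) with mod3 n
... | 0mod3 q = 0mod3 (suc q)
... | 1mod3 q = 1mod3 (suc q)
... | 2mod3 q = 2mod3 (suc q)

𝟙 : Bool → ℕ
𝟙 b = if b then 1 else 0

scale : ℕ → ℕ
scale zero    = 1
scale (suc m) = scale m * 3

scale≥1 : ∀ m → 1 ≤ scale m
scale≥1 zero    = ≤-refl
scale≥1 (suc m) = ≤-trans (scale≥1 m) (m≤m*n (scale m) 3)

+-*3-+ : ∀ r p q → r + p * 3 + q * 3 ≡ r + (p + q) * 3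
+-*3-+ r p q = trans (+-assoc r (p * 3) (q * 3)) (cong (r +_) (sym (*-distribʳ-+ 3 p q)))

-- Encodes s′ ≡ s + 1 (mod 3); the quotients are independent, so either position may be the larger.
data Ahead : ℕ → ℕ → Set where
  ahead₀ : ∀ q q′ → Ahead (q * 3) (1 + q′ * 3)
  ahead₁ : ∀ q q′ → Ahead (1 + q * 3) (2 + q′ * 3)
  ahead₂ : ∀ q q′ → Ahead (2 + q * 3) (q′ * 3)

ahead-suc : ∀ {s s′} → Ahead s s′ → Ahead (suc s) (suc s′)
ahead-suc (ahead₀ q q′) = ahead₁ q q′
ahead-suc (ahead₁ q q′) = ahead₂ q (suc q′)
ahead-suc (ahead₂ q q′) = ahead₀ (suc q) q′

-- Puts the congruence into the subtraction-free form that `Shifted` has at m = 0.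
ahead-shift : ∀ {s s′} → Ahead s s′ → ∃[ x ] ∃[ y ] s + 1 + x * 3 ≡ s′ + y * 3
ahead-shift (ahead₀ q q′) = q′ , q , lemma q q′
  where
  lemma : ∀ q q′ → q * 3 + 1 + q′ * 3 ≡ 1 + q′ * 3 + q * 3
  lemma = solve-∀
ahead-shift (ahead₁ q q′) = q′ , q , lemma q q′
  where
  lemma : ∀ q q′ → 1 + q * 3 + 1 + q′ * 3 ≡ 2 + q′ * 3 + q * 3
  lemma = solve-∀
ahead-shift (ahead₂ q q′) = q′ , suc q , lemma q q′
  where
  lemma : ∀ q q′ → 2 + q * 3 + 1 + q′ * 3 ≡ q′ * 3 + suc q * 3
  lemma = solve-∀

data SamePhase : ℕ → ℕ → Set where
  same : ∀ r q q′ → r < 3 → SamePhase (r + q * 3) (r + q′ * 3)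

comparePhase : ∀ s s′ → SamePhase s s′ ⊎ Ahead s s′ ⊎ Ahead s′ s
comparePhase s s′ with mod3 s | mod3 s′
... | 0mod3 q | 0mod3 q′ = inj₁ (same 0 q q′ (s≤s z≤n))
... | 0mod3 q | 1mod3 q′ = inj₂ (inj₁ (ahead₀ q q′))
... | 0mod3 q | 2mod3 q′ = inj₂ (inj₂ (ahead₂ q′ q))
... | 1mod3 q | 0mod3 q′ = inj₂ (inj₂ (ahead₀ q′ q))
... | 1mod3 q | 1mod3 q′ = inj₁ (same 1 q q′ (s≤s (s≤s z≤n)))
... | 1mod3 q | 2mod3 q′ = inj₂ (inj₁ (ahead₁ q q′))
... | 2mod3 q | 0mod3 q′ = inj₂ (inj₁ (ahead₂ q q′))
... | 2mod3 q | 1mod3 q′ = inj₂ (inj₂ (ahead₁ q′ q))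
... | 2mod3 q | 2mod3 q′ = inj₁ (same 2 q q′ ≤-refl)

same-2mod3 : ∀ {s s′} q → SamePhase s s′ → s ≡ 2 + q * 3 → ∃[ q′ ] s′ ≡ 2 + q′ * 3
same-2mod3 q (same r p p′ r<3) e
  with r | r<3 | trans (sym ([m+kn]%n≡m%n r p 3)) (trans (cong (_% 3) e) ([m+kn]%n≡m%n 2 q 3))
... | 0 | _ | ()
... | 1 | _ | ()
... | 2 | _ | _ = p′ , refl
... | suc (suc (suc _)) | s≤s (s≤s (s≤s ())) | _

-- Elimination and parity in ℕ.

telescope : ∀ g₀ g₁ C₀ C₁ o o′ o″ → g₀ + o ≡ g₁ + o′ → C₀ + o′ ≡ C₁ + o″ → g₀ + C₀ + o ≡ g₁ + C₁ + o″
telescope g₀ g₁ C₀ C₁ o o′ o″ e e′ = begin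
  g₀ + C₀ + o    ≡⟨ swap g₀ C₀ o ⟩
  g₀ + o + C₀    ≡⟨ cong (_+ C₀) e ⟩
  g₁ + o′ + C₀   ≡⟨ assoc g₁ o′ C₀ ⟩
  g₁ + (C₀ + o′) ≡⟨ cong (g₁ +_) e′ ⟩
  g₁ + (C₁ + o″) ≡⟨ +-assoc g₁ C₁ o″ ⟨
  g₁ + C₁ + o″   ∎
  where
  open ≡-Reasoning
  swap : ∀ a b c → a + b + c ≡ a + c + b
  swap = solve-∀
  assoc : ∀ a b c → a + b + c ≡ a + (c + b)
  assoc = solve-∀

-- Let y and x be the numbers of 00^n1 and 10^n1 in a factor and o, e the states at its two ends.
-- Then y + x = 2x + e - o, and equal totals give the conclusion once o and o′ are moved across.
eliminate : ∀ y x o e y′ x′ o′ e′ → y + o ≡ x + e → y′ + o′ ≡ x′ + e′ → y + x ≡ y′ + x′ →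
  x + x + (e + o′) ≡ x′ + x′ + (e′ + o)
eliminate y x o e y′ x′ o′ e′ p p′ t = begin
  x + x + (e + o′)    ≡⟨ lhs x e o′ ⟩
  x + e + x + o′      ≡⟨ cong (λ z → z + x + o′) p ⟨
  y + o + x + o′      ≡⟨ mid y o x o′ ⟩
  y + x + (o + o′)    ≡⟨ cong (_+ (o + o′)) t ⟩
  y′ + x′ + (o + o′)  ≡⟨ mid′ y′ x′ o o′ ⟩
  y′ + o′ + x′ + o    ≡⟨ cong (λ z → z + x′ + o) p′ ⟩
  x′ + e′ + x′ + o    ≡⟨ lhs x′ e′ o ⟨
  x′ + x′ + (e′ + o)  ∎
  where
  open ≡-Reasoning
  lhs : ∀ x e o → x + x + (e + o) ≡ x + e + x + o
  lhs = solve-∀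
  mid : ∀ y o x o′ → y + o + x + o′ ≡ y + x + (o + o′)
  mid = solve-∀
  mid′ : ∀ y x o o′ → y + x + (o + o′) ≡ y + o′ + x + o
  mid′ = solve-∀

double-injective : ∀ x y → x + x ≡ y + y → x ≡ y
double-injective zero    zero    _ = refl
double-injective (suc x) (suc y) e =
  cong suc (double-injective x y (suc-injective (trans (sym (+-suc x x)) (trans (suc-injective e) (+-suc y y)))))

double≢suc-double : ∀ x y → x + x ≢ suc (y + y)
double≢suc-double (suc x) zero    e with trans (sym (+-suc x x)) (suc-injective e)
... | ()
double≢suc-double (suc x) (suc y) e =
  double≢suc-double x y (suc-injective (trans (sym (+-suc x x)) (trans (suc-injective e) (cong suc (+-suc y y)))))

double-cancel : ∀ x y {a b} → x + x + a ≡ y + y + b → a ≡ b → x ≡ y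
double-cancel x y {a} e refl = double-injective x y (+-cancelʳ-≡ a _ _ e)

double-parity : ∀ x y {a b c} → x + x + a ≡ y + y + b → b ≡ suc c → a ≡ c → ⊥
double-parity x y {a} e refl refl =
  double≢suc-double x y (+-cancelʳ-≡ a _ _ (trans e (+-suc (y + y) a)))

-- Sequences fixed by 1 ↦ 101, 0 ↦ 000.

module Fixpoint
  -- The sequence is kept abstract so that `rewrite` and `with` meet only the three equations and
  -- never the unfolded fuel recursion.
  (c : ℕ → Bool)
  (c-0 : ∀ q → c (q * 3) ≡ c q)
  (c-1 : ∀ q → c (1 + q * 3) ≡ false)
  (c-2 : ∀ q → c (2 + q * 3) ≡ c q)
  where

  c-shift : ∀ r p q → c (r + p * 3 + q * 3) ≡ c (r + (p + q) * 3)
  c-shift r p q = cong c (+-*3-+ r p q)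

  c-*3 : ∀ p q → c (p * 3 + q * 3) ≡ c (p + q)
  c-*3 p q = trans (c-shift 0 p q) (c-0 (p + q))

  clash : ∀ {x} → x ≡ true → x ≡ false → ⊥
  clash refl ()

  -- The middle letter of a block is 0, so adjacent ones would straddle a block boundary and come
  -- from adjacent ones at q and q + 1.
  no-11 : ∀ n → c n ≡ true → c (suc n) ≡ true → ⊥
  no-11 n = go n (suc n) ≤-refl
    where
    go : ∀ n f → n < f → c n ≡ true → c (suc n) ≡ true → ⊥
    go n (suc f) (s≤s n≤f) cn csn with mod3 n
    ... | 0mod3 q = clash csn (c-1 q)
    ... | 1mod3 q = clash cn (c-1 q)
    ... | 2mod3 q =
      go q f (≤-trans (s≤s (m≤n⇒m≤1+n (m≤m*n q 3))) n≤f)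
         (trans (sym (c-2 q)) cn) (trans (sym (c-0 (suc q))) csn)

  -- Synchronisation of windows with the blocks.

  Agree : ℕ → ℕ → ℕ → Set
  Agree s s′ L = ∀ j → j < L → c (j + s) ≡ c (j + s′)

  agree-sym : ∀ {s s′ L} → Agree s s′ L → Agree s′ s L
  agree-sym ag j j<L = sym (ag j j<L)

  agree-suc : ∀ {s s′ L} → Agree s s′ (suc L) → Agree (suc s) (suc s′) L
  agree-suc {s} {s′} ag j j<L =
    trans (cong c (+-suc j s)) (trans (ag (suc j) (s≤s j<L)) (cong c (sym (+-suc j s′))))

  -- Four letters suffice to recognise the cutting into blocks 101 and 000.
  ahead⇒zero₄ : ∀ {s s′} → Ahead s s′ → Agree s s′ 4 → ∀ j → j < 4 → c (j + s) ≡ false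
  ahead⇒zero₄ {s} {s′} a ag = go a
    where
    ag₀ : c s ≡ c s′
    ag₀ = ag 0 (s≤s z≤n)
    ag₁ : c (1 + s) ≡ c (1 + s′)
    ag₁ = ag 1 (s≤s (s≤s z≤n))
    ag₂ : c (2 + s) ≡ c (2 + s′)
    ag₂ = ag 2 (s≤s (s≤s (s≤s z≤n)))
    ag₃ : c (3 + s) ≡ c (3 + s′)
    ag₃ = ag 3 ≤-refl
    go : Ahead s s′ → ∀ j → j < 4 → c (j + s) ≡ false
    go (ahead₀ q q′) 0 _ = trans ag₀ (c-1 q′)
    go (ahead₀ q q′) 1 _ = c-1 q
    go (ahead₀ q q′) 2 _ = trans (c-2 q) (trans (sym (c-0 q)) (trans ag₀ (c-1 q′)))
    go (ahead₀ q q′) 3 _ = trans ag₃ (c-1 (suc q′))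
    go (ahead₁ q q′) 0 _ = c-1 q
    go (ahead₁ q q′) 1 _ =
      trans ag₁ (trans (c-0 (suc q′)) (trans (sym (c-2 (suc q′))) (trans (sym ag₃) (c-1 (suc q)))))
    go (ahead₁ q q′) 2 _ = trans ag₂ (c-1 (suc q′))
    go (ahead₁ q q′) 3 _ = c-1 (suc q)
    go (ahead₂ q q′) 0 _ =
      trans ag₀ (trans (c-0 q′) (trans (sym (c-2 q′)) (trans (sym ag₂) (c-1 (suc q)))))
    go (ahead₂ q q′) 1 _ = trans ag₁ (c-1 q′)
    go (ahead₂ q q′) 2 _ = c-1 (suc q)
    go (ahead₂ q q′) 3 _ =
      trans (c-2 (suc q)) (trans (sym (c-0 (suc q))) (trans ag₁ (c-1 q′)))
    go _ (suc (suc (suc (suc _)))) (s≤s (s≤s (s≤s (s≤s ()))))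

  ahead⇒zero : ∀ {s s′} L → Ahead s s′ → Agree s s′ (4 + L) →
    ∀ j → j < 4 + L → c (j + s) ≡ false
  ahead⇒zero zero a ag j j<4 = ahead⇒zero₄ a ag j j<4
  ahead⇒zero (suc L) a ag zero _ = ahead⇒zero₄ a (λ j j<4 → ag j (≤-trans j<4 (m≤m+n 4 (suc L)))) 0 (s≤s z≤n)
  ahead⇒zero {s} (suc L) a ag (suc j) (s≤s j<L) =
    trans (cong c (sym (+-suc j s))) (ahead⇒zero L (ahead-suc a) (agree-suc ag) j j<L)

  -- If the residues differ, one position is a step ahead of the other, in one order or the other,
  -- and then the whole window vanishes.
  recognise : ∀ {s s′ L} → 4 ≤ L → Agree s s′ L →
    ∀ j → j < L → c (j + s) ≡ true → SamePhase s s′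
  recognise {s} {s′} {suc (suc (suc (suc L)))} (s≤s (s≤s (s≤s (s≤s z≤n)))) ag j j<L cj with comparePhase s s′
  ... | inj₁ p = p
  ... | inj₂ (inj₁ a) = ⊥-elim (clash cj (ahead⇒zero L a ag j j<L))
  ... | inj₂ (inj₂ a) =
    ⊥-elim (clash (trans (sym (ag j j<L)) cj) (ahead⇒zero L a (agree-sym ag) j j<L))

  -- Gaps between ones, and words with all four extensions.

  mutual
    -- A gap of two or more zeros runs from the end of one block to the start of another, hence is
    -- the image of a gap a third as long; the descent stops at length 1. The bound f carries the
    -- recursion.
    gap-scale : ∀ f ℓ i → ℓ ≤ f → c i ≡ true → (∀ j → j < ℓ → c (j + suc i) ≡ false) →
      c (ℓ + suc i) ≡ true → ∃[ m ] ℓ ≡ scale m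
    gap-scale f 0 i _ ci _ ce = ⊥-elim (no-11 i ci ce)
    gap-scale f 1 i _ _ _ _ = 0 , refl
    gap-scale (suc f) ℓ@(suc (suc _)) i ℓ≤f = gap-scale-step f ℓ i (s≤s (s≤s z≤n)) ℓ≤f

    -- Here ℓ is a variable again, so that `mod3 ℓ` can be matched on.
    gap-scale-step : ∀ f ℓ i → 1 < ℓ → ℓ ≤ suc f → c i ≡ true →
      (∀ j → j < ℓ → c (j + suc i) ≡ false) → c (ℓ + suc i) ≡ true → ∃[ m ] ℓ ≡ scale m
    gap-scale-step f ℓ i 1<ℓ ℓ≤f ci z ce with mod3 i | mod3 ℓ
    ... | 0mod3 q | _ = ⊥-elim (clash ci (trans (c-0 q) (trans (sym (c-2 q)) (z 1 1<ℓ))))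
    ... | 1mod3 q | _ = ⊥-elim (clash ci (c-1 q))
    ... | 2mod3 q | 1mod3 t = ⊥-elim (clash ce (trans (c-shift 1 t (suc q)) (c-1 (t + suc q))))
    ... | 2mod3 q | 2mod3 t =
      ⊥-elim (clash ce (trans (c-shift 2 t (suc q)) (trans (c-2 (t + suc q)) (trans (sym (c-0 (t + suc q)))
        (trans (sym (c-shift 0 t (suc q))) (z (t * 3) (s≤s (n≤1+n _))))))))
    ... | 2mod3 q | 0mod3 t@(suc t′)
      with gap-scale f t q (≤-trans (s≤s (m≤n⇒m≤1+n (m≤m*n t′ 3))) (s≤s⁻¹ ℓ≤f))
             (trans (sym (c-2 q)) ci)
             (λ j j<t → trans (sym (c-*3 j (suc q))) (z (j * 3) (*-monoˡ-< 3 j<t)))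
             (trans (sym (c-*3 t (suc q))) ce)
    ... | m , e = suc m , cong (_* 3) e

  -- At residue 0 the letters two places on would repeat the differing letters at s and s′; at
  -- residue 1 there is no one.
  last-of-block : ∀ {s s′} → SamePhase s s′ → c s ≡ true → c s′ ≡ false →
    c (2 + s) ≡ c (2 + s′) → ∃[ q ] s ≡ 2 + q * 3
  last-of-block (same 0 q q′ _) cs cs′ e =
    ⊥-elim (clash (trans (c-2 q) (trans (sym (c-0 q)) cs))
                  (trans e (trans (c-2 q′) (trans (sym (c-0 q′)) cs′))))
  last-of-block (same 1 q q′ _) cs _ _ = ⊥-elim (clash cs (c-1 q))
  last-of-block (same 2 q q′ _) _ _ _ = q , refl
  last-of-block (same (suc (suc (suc _))) _ _ (s≤s (s≤s (s≤s ())))) _ _ _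

  mutual
    -- `i a b` is the start of an occurrence of awb, with ℓ the length of w. A one in w aligns the
    -- four occurrences modulo 3, and the varying outer letters force both ends of w onto block
    -- boundaries. So w is the image of a shorter word that has a one and all four extensions.
    bispecial-zero : ∀ f ℓ (i : Bool → Bool → ℕ) → ℓ ≤ f → (∀ a b → c (i a b) ≡ a) →
      (∀ a b → Agree (suc (i true true)) (suc (i a b)) ℓ) → (∀ a b → c (ℓ + suc (i a b)) ≡ b) →
      ∀ j → j < ℓ → c (j + suc (i true true)) ≡ true → ⊥
    bispecial-zero f 1 i _ l w r 0 _ cj = no-11 _ (l true true) cj
    bispecial-zero f 2 i _ l w r 0 _ cj = no-11 _ (l true true) cj
    bispecial-zero f 2 i _ l w r 1 _ cj = no-11 _ cj (r true true)
    bispecial-zero f 3 i _ l w r 0 _ cj = no-11 _ (l true true) cj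
    bispecial-zero f 3 i _ l w r 1 _ cj with i true true | l true true | r true true
    -- The ones at p, p + 2 and p + 4 meet every residue modulo 3, so one of them is the middle of a
    -- block.
    ... | p | cp | cr with mod3 p
    ... | 0mod3 q = clash cr (c-1 (suc q))
    ... | 1mod3 q = clash cp (c-1 q)
    ... | 2mod3 q = clash cj (c-1 (suc q))
    bispecial-zero f 3 i _ l w r 2 _ cj = no-11 _ cj (r true true)
    bispecial-zero f 1 i _ l w r (suc _) (s≤s ()) cj
    bispecial-zero f 2 i _ l w r (suc (suc _)) (s≤s (s≤s ())) cj
    bispecial-zero f 3 i _ l w r (suc (suc (suc _))) (s≤s (s≤s (s≤s ()))) cj
    bispecial-zero (suc f) ℓ@(suc (suc (suc (suc L)))) i ℓ≤f l w r j j<ℓ cj =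
      bispecial-zero-step f ℓ q (s≤s (s≤s z≤n)) ℓ≤f
        (λ a b → subst (λ x → c x ≡ a) (q≡ a b) (l a b))
        (λ a b → subst₂ (λ x y → Agree (suc x) (suc y) ℓ) (q≡ true true) (q≡ a b) (w a b))
        (λ a b → subst (λ x → c (ℓ + suc x) ≡ b) (q≡ a b) (r a b))
        j j<ℓ (subst (λ x → c (j + suc x) ≡ true) (q≡ true true) cj)
      where
      aligned : ∀ a b → SamePhase (i true true) (i a b)
      aligned a b with comparePhase (i true true) (i a b)
      ... | inj₁ p = p
      ... | inj₂ (inj₁ x) = ⊥-elim (clash cj (ahead⇒zero L (ahead-suc x) (w a b) j j<ℓ))
      ... | inj₂ (inj₂ x) =
        ⊥-elim (clash (trans (sym (w a b j j<ℓ)) cj)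
                      (ahead⇒zero L (ahead-suc x) (agree-sym (w a b)) j j<ℓ))
      -- The occurrences of 1w1 and 0w1 differ in their first letter and agree two letters on, so w
      -- begins at a block boundary.
      p,p≡ = last-of-block (aligned false true) (l true true) (l false true) (w false true 1 (s≤s (s≤s z≤n)))
      q : Bool → Bool → ℕ
      q a b = proj₁ (same-2mod3 (proj₁ p,p≡) (aligned a b) (proj₂ p,p≡))
      q≡ : ∀ a b → i a b ≡ 2 + q a b * 3
      q≡ a b = proj₂ (same-2mod3 (proj₁ p,p≡) (aligned a b) (proj₂ p,p≡))

    -- With w starting a block, a right-hand letter in the middle of a block is always 0, and one at
    -- the end of a block repeats a letter of w. Neither can vary, so 3 divides ℓ.
    bispecial-zero-step : ∀ f ℓ (q : Bool → Bool → ℕ) → 1 < ℓ → ℓ ≤ suc f → (∀ a b → c (2 + q a b * 3) ≡ a) →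
      (∀ a b → Agree (3 + q true true * 3) (3 + q a b * 3) ℓ) → (∀ a b → c (ℓ + (3 + q a b * 3)) ≡ b) →
      ∀ j → j < ℓ → c (j + (3 + q true true * 3)) ≡ true → ⊥
    bispecial-zero-step f ℓ q 1<ℓ ℓ≤f l w r j j<ℓ cj with mod3 ℓ
    ... | 1mod3 t = clash (r true true) (trans (c-shift 1 t (suc p)) (c-1 (t + suc p)))
      where p = q true true
    ... | 2mod3 t =
      clash (trans (sym (last true)) (r true true))
            (trans (w true false (t * 3) (s≤s (n≤1+n _))) (trans (sym (last false)) (r true false)))
      where
      last : ∀ b → c (2 + t * 3 + (3 + q true b * 3)) ≡ c (t * 3 + (3 + q true b * 3))
      last b = trans (c-shift 2 t p) (trans (c-2 (t + p)) (sym (c-*3 t p)))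
        where p = suc (q true b)
    ... | 0mod3 (suc t) with mod3 j
    ...   | 1mod3 x = clash cj (trans (c-shift 1 x (suc p)) (c-1 (x + suc p)))
      where p = q true true
    ...   | 0mod3 x = bispecial-zero-descend f (suc t) q ℓ≤f l w r x
              (*-cancelʳ-< 3 x (suc t) j<ℓ) (trans (sym (c-*3 x (suc p))) cj)
      where p = q true true
    ...   | 2mod3 x = bispecial-zero-descend f (suc t) q ℓ≤f l w r x
              (*-cancelʳ-< 3 x (suc t) (≤-trans (s≤s (≤-trans (n≤1+n _) (n≤1+n _))) j<ℓ))
              (trans (sym (trans (c-shift 2 x (suc p)) (c-2 (x + suc p)))) cj)
      where p = q true true

    bispecial-zero-descend : ∀ f t (q : Bool → Bool → ℕ) → t * 3 ≤ suc f → (∀ a b → c (2 + q a b * 3) ≡ a) →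
      (∀ a b → Agree (3 + q true true * 3) (3 + q a b * 3) (t * 3)) →
      (∀ a b → c (t * 3 + (3 + q a b * 3)) ≡ b) →
      ∀ j → j < t → c (j + suc (q true true)) ≡ true → ⊥
    bispecial-zero-descend f t@(suc t′) q t≤f l w r =
      bispecial-zero f t q (≤-trans (s≤s (m≤n⇒m≤1+n (m≤m*n t′ 3))) (s≤s⁻¹ t≤f))
        (λ a b → trans (sym (c-2 (q a b))) (l a b))
        (λ a b j j<t → trans (sym (c-*3 j (suc (q true true))))
          (trans (w a b (j * 3) (*-monoˡ-< 3 j<t)) (c-*3 j (suc (q a b)))))
        (λ a b → trans (sym (c-*3 t (suc (q a b)))) (r a b))

  -- Alternation of 00^n1 and 10^n1.

  -- With n = 3^m, the occurrences of 00^n1 and 10^n1 alternate along c; opens m i says that the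
  -- last of them starting before i is a 00^n1.  For m = 0 this means that 101 starts at i or i + 1.
  opens : ℕ → ℕ → Bool
  opens zero    i = (c i ∧ c (2 + i)) ∨ (c (1 + i) ∧ c (3 + i))
  opens (suc m) i = opens m (i / 3)

  opens₀-0 : ∀ q → opens 0 (q * 3) ≡ c (q * 3)
  opens₀-0 q rewrite c-0 q | c-1 q | c-2 q with c q
  ... | true  = refl
  ... | false = refl

  opens₀-1 : ∀ q → opens 0 (1 + q * 3) ≡ false
  opens₀-1 q rewrite c-1 q | c-1 (suc q) = ∧-zeroʳ (c (2 + q * 3))

  opens₀-2 : ∀ q → opens 0 (2 + q * 3) ≡ c (3 + q * 3)
  opens₀-2 q rewrite c-0 (suc q) | c-1 (suc q) | c-2 (suc q) with c (suc q) | c (2 + q * 3)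
  ... | true  | x = cong (_∨ true) (∧-zeroʳ x)
  ... | false | x = cong (_∨ false) (∧-zeroʳ x)

  opens-suc : ∀ m r q → r < 3 → opens (suc m) (r + q * 3) ≡ opens m q
  opens-suc m r q r<3 = cong (opens m) (trans (+q*3/3 r q) (cong (_+ q) (m<n⇒m/n≡0 r<3)))

  zeros : ℕ → ℕ → Bool
  zeros zero    i = true
  zeros (suc n) i = not (c i) ∧ zeros n (suc i)

  zeros⇒c : ∀ n i → zeros n i ≡ true → ∀ j → j < n → c (j + i) ≡ false
  zeros⇒c (suc n) i z j j<n with c i in ci
  zeros⇒c (suc n) i z zero    j<n       | false = ci
  zeros⇒c (suc n) i z (suc j) (s≤s j<n) | false =
    trans (cong c (sym (+-suc j i))) (zeros⇒c n (suc i) z j j<n)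

  zeros-*3 : ∀ n q → zeros (n * 3) (q * 3) ≡ zeros n q
  zeros-*3 zero    q = refl
  zeros-*3 (suc n) q rewrite c-0 q | c-1 q | c-2 q | zeros-*3 n (suc q) with c q
  ... | true  = refl
  ... | false = refl

  gapAt : Bool → ℕ → ℕ → Bool
  gapAt b n i = does (b ≟ c i) ∧ zeros n (suc i) ∧ c (n + suc i)

  -- The closing 1 would be the middle letter of a block.
  gapAt-0 : ∀ b n q → gapAt b (n * 3) (q * 3) ≡ false
  gapAt-0 b n q
    rewrite trans (cong c (+-suc (n * 3) (q * 3))) (trans (c-shift 1 n q) (c-1 (n + q)))
          | ∧-zeroʳ (zeros (n * 3) (1 + q * 3)) = ∧-zeroʳ _

  gapAt-1 : ∀ b n q → 1 ≤ n → gapAt b (n * 3) (1 + q * 3) ≡ false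
  gapAt-1 b n@(suc n′) q _ with zeros (n * 3) (2 + q * 3) in z
  ... | false = ∧-zeroʳ _
  ... | true =
    trans (cong (does (b ≟ c (1 + q * 3)) ∧_) end) (∧-zeroʳ _)
    where
    end : c (n * 3 + (2 + q * 3)) ≡ false
    end = trans (cong c (trans (+-suc (n * 3) (1 + q * 3)) (cong suc (+-suc (n * 3) (q * 3)))))
      (trans (c-shift 2 n q) (trans (c-2 (n + q)) (trans (sym (c-*3 n q)) (
        trans (cong c (sym (cong suc (trans (+-suc (n′ * 3) (1 + q * 3)) (cong suc (+-suc (n′ * 3) (q * 3)))))))
          -- The closing 1 would end a block whose first letter, two places earlier, is already one
          -- of the zeros.
          (zeros⇒c (n * 3) (2 + q * 3) z (1 + n′ * 3) (n≤1+n _))))))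

  gapAt-2 : ∀ b n q → gapAt b (n * 3) (2 + q * 3) ≡ gapAt b n q
  gapAt-2 b n q rewrite c-2 q | zeros-*3 n (suc q) | c-*3 n (suc q) = refl

  -- 00^n1 switches the state on and 10^n1 switches it off. The case m = 0 is a check of residues;
  -- for larger m nothing happens except at the last letter of a block, where the identity is the
  -- one for m - 1 at q.
  gap-balance : ∀ m i →
    𝟙 (gapAt false (scale m) i) + 𝟙 (opens m i) ≡ 𝟙 (gapAt true (scale m) i) + 𝟙 (opens m (suc i))
  gap-balance zero i with mod3 i
  ... | 0mod3 q rewrite opens₀-0 q | opens₀-1 q | c-0 q | c-1 q | c-2 q with c q
  ...   | true  = refl
  ...   | false = refl
  gap-balance zero i | 1mod3 q
    rewrite opens₀-1 q | opens₀-2 q | c-1 q | c-2 q with c q in cq | c (3 + q * 3) in csq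
  ...   | true  | true  = ⊥-elim (no-11 q cq (trans (sym (c-0 (suc q))) csq))
  ...   | true  | false = refl
  ...   | false | true  = refl
  ...   | false | false = refl
  gap-balance zero i | 2mod3 q
    rewrite opens₀-2 q | opens₀-0 (suc q) | c-1 (suc q)
          | ∧-zeroʳ (not (c (3 + q * 3)) ∧ true)
          | ∧-zeroʳ (does (false ≟ c (2 + q * 3))) | ∧-zeroʳ (does (true ≟ c (2 + q * 3))) = refl
  gap-balance (suc m) i with mod3 i
  ... | 0mod3 q
    rewrite gapAt-0 false (scale m) q | gapAt-0 true (scale m) q
          | opens-suc m 0 q (s≤s z≤n) | opens-suc m 1 q (s≤s (s≤s z≤n)) = refl
  ... | 1mod3 q
    rewrite gapAt-1 false (scale m) q (scale≥1 m) | gapAt-1 true (scale m) q (scale≥1 m)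
          | opens-suc m 1 q (s≤s (s≤s z≤n)) | opens-suc m 2 q ≤-refl = refl
  ... | 2mod3 q
    rewrite gapAt-2 false (scale m) q | gapAt-2 true (scale m) q
          | opens-suc m 2 q ≤-refl | opens-suc m 0 (suc q) (s≤s z≤n) = gap-balance m q

  -- What a window reveals about the state.

  search : ∀ L s → (∃[ j ] j < L × c (j + s) ≡ true) ⊎ (∀ j → j < L → c (j + s) ≡ false)
  search zero s = inj₂ λ _ ()
  search (suc L) s with c s in cs | search L (suc s)
  ... | true  | _ = inj₁ (0 , s≤s z≤n , cs)
  ... | false | inj₁ (j , j<L , cj) = inj₁ (suc j , s≤s j<L , trans (cong c (sym (+-suc j s))) cj)
  ... | false | inj₂ z = inj₂ λ where
    zero    _         → cs
    (suc j) (s≤s j<L) → trans (cong c (sym (+-suc j s))) (z j j<L)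

  -- A window of length 3n + 1 shows enough of each of the n + 1 blocks it begins with to identify it.
  block-in-window : ∀ r n j → r < 3 → 1 ≤ n → j ≤ n →
    ∃[ t ] t ≤ n * 3 × (∀ a → c (t + (r + a * 3)) ≡ c (j + a))
  block-in-window 0 n 0 _ 1≤n _ = 2 , ≤-trans (n≤1+n 2) (*-monoˡ-≤ 3 1≤n) , c-2
  block-in-window 1 n 0 _ 1≤n _ = 1 , ≤-trans (≤-trans (n≤1+n 1) (n≤1+n 2)) (*-monoˡ-≤ 3 1≤n) , c-2
  block-in-window 2 n 0 _ 1≤n _ = 0 , z≤n , c-2
  block-in-window 0 n (suc j) _ _ j≤n = suc j * 3 , *-monoˡ-≤ 3 j≤n , c-*3 (suc j)
  block-in-window 1 n (suc j) _ _ j≤n = 2 + j * 3 , ≤-trans (n≤1+n _) (*-monoˡ-≤ 3 j≤n) ,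
    λ a → trans (cong c (+-suc (2 + j * 3) (a * 3))) (c-*3 (suc j) a)
  block-in-window 2 n (suc j) _ _ j≤n =
    1 + j * 3 , ≤-trans (≤-trans (n≤1+n _) (n≤1+n _)) (*-monoˡ-≤ 3 j≤n) ,
    λ a → trans (cong c (trans (+-suc (1 + j * 3) (1 + a * 3)) (cong suc (+-suc (1 + j * 3) (a * 3)))))
                (c-*3 (suc j) a)
  block-in-window (suc (suc (suc _))) _ _ (s≤s (s≤s (s≤s ()))) _ _

  agree-blocks : ∀ r q q′ n → r < 3 → 1 ≤ n →
    Agree (r + q * 3) (r + q′ * 3) (suc (n * 3)) → Agree q q′ (suc n)
  agree-blocks r q q′ n r<3 1≤n ag j (s≤s j≤n) with block-in-window r n j r<3 1≤n j≤n
  ... | t , t≤ , e = trans (sym (e q)) (trans (ag t (s≤s t≤)) (e q′))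

  -- Passing to blocks m times leaves a window of two zeros, and `opens 0` is false or one of these
  -- two letters.
  opens-zeros : ∀ m i → (∀ j → j < suc (scale m) → c (j + i) ≡ false) → opens m i ≡ false
  opens-zeros zero i z with mod3 i
  ... | 0mod3 q = trans (opens₀-0 q) (z 0 (s≤s z≤n))
  ... | 1mod3 q = opens₀-1 q
  ... | 2mod3 q = trans (opens₀-2 q) (z 1 ≤-refl)
  opens-zeros (suc m) i z with mod3 i
  ... | 0mod3 q = trans (opens-suc m 0 q (s≤s z≤n)) (opens-zeros m q λ j → λ where
    (s≤s j≤n) → let t , t≤ , e = block-in-window 0 (scale m) j (s≤s z≤n) (scale≥1 m) j≤n
                in trans (sym (e q)) (z t (s≤s t≤)))
  ... | 1mod3 q = trans (opens-suc m 1 q (s≤s (s≤s z≤n))) (opens-zeros m q λ j → λ where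
    (s≤s j≤n) → let t , t≤ , e = block-in-window 1 (scale m) j (s≤s (s≤s z≤n)) (scale≥1 m) j≤n
                in trans (sym (e q)) (z t (s≤s t≤)))
  ... | 2mod3 q = trans (opens-suc m 2 q ≤-refl) (opens-zeros m q λ j → λ where
    (s≤s j≤n) → let t , t≤ , e = block-in-window 2 (scale m) j ≤-refl (scale≥1 m) j≤n
                in trans (sym (e q)) (z t (s≤s t≤)))

  -- The field shift is s ≡ s′ + n (mod 3n) for n = 3^m, with multiples on both sides to avoid subtraction.
  record Shifted (m s s′ : ℕ) : Set where
    constructor shifted
    field
      s-opens  : opens m s ≡ true
      s′-opens : opens m s′ ≡ false
      x y      : ℕ
      shift    : s′ + scale m + x * (scale m * 3) ≡ s + y * (scale m * 3)

  open Shifted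

  shift-*3 : ∀ r q q′ n x y → q′ + n + x * (n * 3) ≡ q + y * (n * 3) →
    r + q′ * 3 + n * 3 + x * (n * 3 * 3) ≡ r + q * 3 + y * (n * 3 * 3)
  shift-*3 r q q′ n x y e =
    trans (lhs r q′ n x) (trans (cong (λ z → r + z * 3) e) (rhs r q n y))
    where
    lhs : ∀ r q n x → r + q * 3 + n * 3 + x * (n * 3 * 3) ≡ r + (q + n + x * (n * 3)) * 3
    lhs = solve-∀
    rhs : ∀ r q n y → r + (q + y * (n * 3)) * 3 ≡ r + q * 3 + y * (n * 3 * 3)
    rhs = solve-∀

  shifted-*3 : ∀ m r q q′ → r < 3 → Shifted m q q′ → Shifted (suc m) (r + q * 3) (r + q′ * 3)
  shifted-*3 m r q q′ r<3 (shifted o o′ x y e) =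
    shifted (trans (opens-suc m r q r<3) o) (trans (opens-suc m r q′ r<3) o′) x y
      (shift-*3 r q q′ (scale m) x y e)

  opens₀-same : ∀ {s s′} → SamePhase s s′ → c s ≡ c s′ → c (suc s) ≡ c (suc s′) → opens 0 s ≡ opens 0 s′
  opens₀-same (same 0 q q′ _) e₀ _ = trans (opens₀-0 q) (trans e₀ (sym (opens₀-0 q′)))
  opens₀-same (same 1 q q′ _) _ _ = trans (opens₀-1 q) (sym (opens₀-1 q′))
  opens₀-same (same 2 q q′ _) _ e₁ = trans (opens₀-2 q) (trans e₁ (sym (opens₀-2 q′)))
  opens₀-same (same (suc (suc (suc _))) _ _ (s≤s (s≤s (s≤s ())))) _ _

  -- At residues 0 and 2 the state is a block's first letter, at s or s + 1; the window at s′ has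
  -- the middle of a block there.
  ahead⇒closed : ∀ {s s′} → Ahead s s′ → Agree s s′ 2 → opens 0 s ≡ false
  ahead⇒closed (ahead₀ q q′) ag = trans (opens₀-0 q) (trans (ag 0 (s≤s z≤n)) (c-1 q′))
  ahead⇒closed (ahead₁ q q′) _  = opens₀-1 q
  ahead⇒closed (ahead₂ q q′) ag = trans (opens₀-2 q) (trans (ag 1 ≤-refl) (c-1 q′))

  opens₀-ahead : ∀ {s s′} → Ahead s s′ → Agree s s′ 2 → opens 0 s ≡ opens 0 s′ ⊎ Shifted 0 s′ s
  opens₀-ahead {s} {s′} a ag with opens 0 s′ in o′
  ... | false = inj₁ (ahead⇒closed a ag)
  ... | true with ahead-shift a
  ...   | x , y , e = inj₂ (shifted o′ (ahead⇒closed a ag) x y e)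

  -- Windows of zeros leave both states off. For m ≥ 1 the window has at least four letters, so a
  -- one in it fixes the residue modulo 3 and the claim descends to the blocks. At m = 0 the
  -- residues are compared directly.
  opens-agree : ∀ m s s′ → Agree s s′ (suc (scale m)) →
    opens m s ≡ opens m s′ ⊎ Shifted m s s′ ⊎ Shifted m s′ s
  opens-agree zero s s′ ag with comparePhase s s′
  ... | inj₁ p = inj₁ (opens₀-same p (ag 0 (s≤s z≤n)) (ag 1 ≤-refl))
  ... | inj₂ (inj₁ a) with opens₀-ahead a ag
  ...   | inj₁ e  = inj₁ e
  ...   | inj₂ sh = inj₂ (inj₂ sh)
  opens-agree zero s s′ ag | inj₂ (inj₂ a) with opens₀-ahead a (agree-sym ag)
  ...   | inj₁ e  = inj₁ (sym e)
  ...   | inj₂ sh = inj₂ (inj₁ sh)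
  opens-agree (suc m) s s′ ag with search (suc (scale (suc m))) s
  ... | inj₂ z = inj₁ (trans (opens-zeros (suc m) s z)
    (sym (opens-zeros (suc m) s′ λ j j<L → trans (sym (ag j j<L)) (z j j<L))))
  ... | inj₁ (j , j<L , cj) with recognise (s≤s (*-monoˡ-≤ 3 (scale≥1 m))) ag j j<L cj
  ...   | same r q q′ r<3 with opens-agree m q q′ (agree-blocks r q q′ (scale m) r<3 (scale≥1 m) ag)
  ...     | inj₁ e = inj₁ (trans (opens-suc m r q r<3) (trans e (sym (opens-suc m r q′ r<3))))
  ...     | inj₂ (inj₁ sh) = inj₂ (inj₁ (shifted-*3 m r q q′ r<3 sh))
  ...     | inj₂ (inj₂ sh) = inj₂ (inj₂ (shifted-*3 m r q′ q r<3 sh))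

  -- Counting gap words between two positions.

  countGaps : Bool → ℕ → ℕ → ℕ → ℕ
  countGaps b n zero    s = 0
  countGaps b n (suc d) s = 𝟙 (gapAt b n s) + countGaps b n d (suc s)

  countGaps-balance : ∀ m d s →
    countGaps false (scale m) d s + 𝟙 (opens m s) ≡ countGaps true (scale m) d s + 𝟙 (opens m (d + s))
  countGaps-balance m zero    s = refl
  countGaps-balance m (suc d) s =
    telescope (𝟙 (gapAt false (scale m) s)) (𝟙 (gapAt true (scale m) s)) _ _ _ _ _ (gap-balance m s)
      (trans (countGaps-balance m d (suc s))
             (cong (λ x → countGaps true (scale m) d (suc s) + 𝟙 (opens m x)) (+-suc d s)))

  -- The congruences s ≡ s′ + n and s′ ≡ s + n (mod 3n) add up to 2n ≡ 0, that is, 2 ≡ 0 (mod 3).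
  -- The common d reflects the equal lengths.
  opposite-shifts : ∀ m s s′ d → Shifted m s s′ → Shifted m (d + s′) (d + s) → ⊥
  opposite-shifts m s s′ d (shifted _ _ x y e) (shifted _ _ x′ y′ e′)
    with scale m | scale≥1 m
  ... | n@(suc _) | _
    with trans (sym ([m+kn]%n≡m%n 2 (x + x′) 3)) (trans (cong (_% 3) 2≡0) (m*n%n≡0 (y + y′) 3))
    where
    lhs : ∀ s s′ d n x x′ → s′ + n + x * (n * 3) + (d + s + n + x′ * (n * 3)) ≡
                            s + s′ + d + (2 + (x + x′) * 3) * n
    lhs = solve-∀
    rhs : ∀ s s′ d n y y′ → s + y * (n * 3) + (d + s′ + y′ * (n * 3)) ≡
                            s + s′ + d + (y + y′) * 3 * n
    rhs = solve-∀
    2≡0 : 2 + (x + x′) * 3 ≡ (y + y′) * 3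
    2≡0 = *-cancelʳ-≡ _ _ n (+-cancelˡ-≡ (s + s′ + d) _ _
      (trans (sym (lhs s s′ d n x x′)) (trans (cong₂ _+_ e e′) (rhs s s′ d n y y′))))
  ... | ()

  -- If the states differ at neither end, or at both in the same direction, the corrections cancel.
  -- A difference at one end only contradicts parity, and opposite directions are excluded by
  -- `opposite-shifts`.
  shifts-balance : ∀ m s s′ d X X′ →
    X + X + (𝟙 (opens m (d + s)) + 𝟙 (opens m s′)) ≡ X′ + X′ + (𝟙 (opens m (d + s′)) + 𝟙 (opens m s)) →
    opens m s ≡ opens m s′ ⊎ Shifted m s s′ ⊎ Shifted m s′ s →
    opens m (d + s) ≡ opens m (d + s′) ⊎ Shifted m (d + s) (d + s′) ⊎ Shifted m (d + s′) (d + s) →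
    X ≡ X′
  shifts-balance m s s′ d X X′ e (inj₁ p) (inj₁ q) =
    double-cancel X X′ e (cong₂ _+_ (cong 𝟙 q) (cong 𝟙 (sym p)))
  shifts-balance m s s′ d X X′ e (inj₁ p) (inj₂ (inj₁ q)) = ⊥-elim (double-parity X′ X (sym e)
    (cong₂ _+_ (cong 𝟙 (s-opens q)) (cong 𝟙 (sym p))) (cong₂ _+_ (cong 𝟙 (s′-opens q)) refl))
  shifts-balance m s s′ d X X′ e (inj₁ p) (inj₂ (inj₂ q)) = ⊥-elim (double-parity X X′ e
    (cong₂ _+_ (cong 𝟙 (s-opens q)) (cong 𝟙 p)) (cong₂ _+_ (cong 𝟙 (s′-opens q)) refl))
  shifts-balance m s s′ d X X′ e (inj₂ (inj₁ p)) (inj₁ q) = ⊥-elim (double-parity X X′ e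
    (trans (cong₂ _+_ (cong 𝟙 (sym q)) (cong 𝟙 (s-opens p))) (+-comm _ 1))
    (trans (cong (𝟙 (opens m (d + s)) +_) (cong 𝟙 (s′-opens p))) (+-identityʳ _)))
  shifts-balance m s s′ d X X′ e (inj₂ (inj₂ p)) (inj₁ q) = ⊥-elim (double-parity X′ X (sym e)
    (trans (cong₂ _+_ (cong 𝟙 q) (cong 𝟙 (s-opens p))) (+-comm _ 1))
    (trans (cong (𝟙 (opens m (d + s′)) +_) (cong 𝟙 (s′-opens p))) (+-identityʳ _)))
  shifts-balance m s s′ d X X′ e (inj₂ (inj₁ p)) (inj₂ (inj₁ q)) = double-cancel X X′ e
    (trans (cong₂ _+_ (cong 𝟙 (s-opens q)) (cong 𝟙 (s′-opens p)))
      (sym (cong₂ _+_ (cong 𝟙 (s′-opens q)) (cong 𝟙 (s-opens p)))))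
  shifts-balance m s s′ d X X′ e (inj₂ (inj₂ p)) (inj₂ (inj₂ q)) = double-cancel X X′ e
    (trans (cong₂ _+_ (cong 𝟙 (s′-opens q)) (cong 𝟙 (s-opens p)))
      (sym (cong₂ _+_ (cong 𝟙 (s-opens q)) (cong 𝟙 (s′-opens p)))))
  shifts-balance m s s′ d X X′ e (inj₂ (inj₁ p)) (inj₂ (inj₂ q)) = ⊥-elim (opposite-shifts m s s′ d p q)
  shifts-balance m s s′ d X X′ e (inj₂ (inj₂ p)) (inj₂ (inj₁ q)) = ⊥-elim (opposite-shifts m s′ s d p q)

  countGaps-agree : ∀ m d s s′ → Agree s s′ (suc (scale m)) → Agree (d + s) (d + s′) (suc (scale m)) →
    countGaps false (scale m) d s + countGaps true (scale m) d s ≡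
      countGaps false (scale m) d s′ + countGaps true (scale m) d s′ →
    countGaps true (scale m) d s ≡ countGaps true (scale m) d s′
  countGaps-agree m d s s′ agₛ agₑ total =
    shifts-balance m s s′ d _ _
      (eliminate (countGaps false (scale m) d s) _ _ (𝟙 (opens m (d + s)))
                 (countGaps false (scale m) d s′) _ _ (𝟙 (opens m (d + s′)))
                 (countGaps-balance m d s) (countGaps-balance m d s′) total)
      (opens-agree m s s′ agₛ) (opens-agree m (d + s) (d + s′) agₑ)

open Fixpoint cantor cantor-0 cantor-1 cantor-2

-- Occurrence counts and one-letter extensions.

occ-extendˡ : ∀ y u → occ y u ≡ occ (false ∷ y) u + occ (true ∷ y) u + 𝟙 (isPrefix y u)
occ-extendˡ y [] = refl
occ-extendˡ y (x ∷ u) = trans (cong (𝟙 (isPrefix y (x ∷ u)) +_) (occ-extendˡ y u)) (arith x)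
  where
  shuffle : ∀ p f t q a b → a + b ≡ q → p + (f + t + q) ≡ a + f + (b + t) + p
  shuffle p f t _ a b refl = lemma p f t a b
    where
    lemma : ∀ p f t a b → p + (f + t + (a + b)) ≡ a + f + (b + t) + p
    lemma = solve-∀
  arith : ∀ x → 𝟙 (isPrefix y (x ∷ u)) + (occ (false ∷ y) u + occ (true ∷ y) u + 𝟙 (isPrefix y u)) ≡
    occ (false ∷ y) (x ∷ u) + occ (true ∷ y) (x ∷ u) + 𝟙 (isPrefix y (x ∷ u))
  arith false = shuffle (𝟙 (isPrefix y (false ∷ u))) (occ (false ∷ y) u) _ _ _ 0 (+-identityʳ _)
  arith true  = shuffle (𝟙 (isPrefix y (true ∷ u))) (occ (false ∷ y) u) _ _ 0 _ refl

isWord : List Bool → List Bool → Bool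
isWord y u = does (≡-dec _≟_ y u)

-- The 0-1 indicator of y being a suffix of u, since suffixes have distinct lengths. It recurses
-- like `occ`, so that `occ-extendʳ` can be proved one suffix at a time.
suffixes : List Bool → List Bool → ℕ
suffixes y []      = 𝟙 (isWord y [])
suffixes y (x ∷ u) = 𝟙 (isWord y (x ∷ u)) + suffixes y u

isPrefix-extendʳ : ∀ y u →
  𝟙 (isPrefix y u) ≡ 𝟙 (isPrefix (y ∷ʳ false) u) + 𝟙 (isPrefix (y ∷ʳ true) u) + 𝟙 (isWord y u)
isPrefix-extendʳ []      []          = refl
isPrefix-extendʳ []      (false ∷ u) = refl
isPrefix-extendʳ []      (true ∷ u)  = refl
isPrefix-extendʳ (a ∷ y) []          = refl
isPrefix-extendʳ (a ∷ y) (x ∷ u) with a ≟ x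
... | no _  = refl
... | yes _ = isPrefix-extendʳ y u

occ-extendʳ : ∀ y u → occ y u ≡ occ (y ∷ʳ false) u + occ (y ∷ʳ true) u + suffixes y u
occ-extendʳ y [] = isPrefix-extendʳ y []
occ-extendʳ y (x ∷ u) =
  trans (cong₂ _+_ (isPrefix-extendʳ y (x ∷ u)) (occ-extendʳ y u))
        (shuffle (𝟙 (isPrefix (y ∷ʳ false) (x ∷ u))) _ _ _ _ _)
  where
  shuffle : ∀ a b c d e f → a + b + c + (d + e + f) ≡ a + d + (b + e) + (c + f)
  shuffle = solve-∀

isPrefix-take : ∀ y n u → length y ≤ n → isPrefix y (take n u) ≡ isPrefix y u
isPrefix-take []      n       u       _ = refl
isPrefix-take (a ∷ y) (suc n) []      _ = refl
isPrefix-take (a ∷ y) (suc n) (x ∷ u) (s≤s y≤n) = cong (does (a ≟ x) ∧_) (isPrefix-take y n u y≤n)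

suffixes-suff : ∀ y n u → length y ≤ n → suffixes y (suff n u) ≡ suffixes y u
suffixes-suff y n [] y≤n rewrite 0∸n≡0 n = refl
suffixes-suff y n (x ∷ u) y≤n with n ≤? length u
... | yes n≤u rewrite +-∸-assoc 1 n≤u =
  trans (suffixes-suff y n u y≤n) (sym (cong (λ b → 𝟙 b + suffixes y u)
    (dec-false (≡-dec _≟_ y (x ∷ u)) λ where refl → <-irrefl refl (≤-trans y≤n n≤u))))
... | no n≰u rewrite m≤n⇒m∸n≡0 (≰⇒> n≰u) = refl

-- Factors as windows of the sequence.

length-factorAt : ∀ s L → length (factorAt s L) ≡ L
length-factorAt s zero    = refl
length-factorAt s (suc L) = cong suc (length-factorAt (suc s) L)

take-factorAt : ∀ n s L → n ≤ L → take n (factorAt s L) ≡ factorAt s n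
take-factorAt zero    s L       _         = refl
take-factorAt (suc n) s (suc L) (s≤s n≤L) = cong (cantor s ∷_) (take-factorAt n (suc s) L n≤L)

drop-factorAt : ∀ d s n → drop d (factorAt s (d + n)) ≡ factorAt (d + s) n
drop-factorAt zero    s n = refl
drop-factorAt (suc d) s n = trans (drop-factorAt d (suc s) n) (cong (λ x → factorAt x n) (+-suc d s))

factorAt⇒Agree : ∀ s s′ L → factorAt s L ≡ factorAt s′ L → Agree s s′ L
factorAt⇒Agree s s′ (suc L) e zero    _         = ∷-injectiveˡ e
factorAt⇒Agree s s′ (suc L) e (suc j) (s≤s j<L) =
  trans (cong cantor (sym (+-suc j s)))
    (trans (factorAt⇒Agree (suc s) (suc s′) L (∷-injectiveʳ e) j j<L) (cong cantor (+-suc j s′)))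

zeros⇒factorAt : ∀ L s → (∀ j → j < L → cantor (j + s) ≡ false) → factorAt s L ≡ replicate L false
zeros⇒factorAt zero    s z = refl
zeros⇒factorAt (suc L) s z = cong₂ _∷_ (z 0 (s≤s z≤n))
  (zeros⇒factorAt L (suc s) λ j j<L → trans (cong cantor (+-suc j s)) (z (suc j) (s≤s j<L)))

length-∷ʳ : (b : Bool) (y : List Bool) → length (y ∷ʳ b) ≡ suc (length y)
length-∷ʳ b y = trans (length-++ y) (+-comm (length y) 1)

snoc-factorAt : ∀ w b i → w ∷ʳ b ≡ factorAt i (length (w ∷ʳ b)) →
  w ≡ factorAt i (length w) × cantor (length w + i) ≡ b
snoc-factorAt []      b i e = refl , sym (∷-injectiveˡ e)
snoc-factorAt (x ∷ w) b i e with snoc-factorAt w b (suc i) (∷-injectiveʳ e)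
... | w≡ , c≡ = cong₂ _∷_ (∷-injectiveˡ e) w≡ , trans (cong cantor (sym (+-suc (length w) i))) c≡

isPrefix-factorAt : ∀ w s L → isPrefix w (factorAt s L) ≡ true → w ≡ factorAt s (length w)
isPrefix-factorAt []      s L       _ = refl
isPrefix-factorAt (a ∷ w) s (suc L) p with a ≟ cantor s
... | yes a≡ = cong₂ _∷_ a≡ (isPrefix-factorAt w (suc s) L p)

occ-factorAt : ∀ w s L → occ w (factorAt s L) ≡ 0 ⊎ ∃[ i ] w ≡ factorAt i (length w)
-- The empty word occurs once in itself, so only the second alternative is open; any position would
-- do.
occ-factorAt []        s zero    = inj₂ (0 , refl)
occ-factorAt (_ ∷ _)   s zero    = inj₁ refl
occ-factorAt w s (suc L) with isPrefix w (factorAt s (suc L)) in p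
... | true  = inj₂ (s , isPrefix-factorAt w s (suc L) p)
... | false = occ-factorAt w (suc s) L

isPrefix-long : ∀ w u → length u < length w → isPrefix w u ≡ false
isPrefix-long (a ∷ w) []      _         = refl
isPrefix-long (a ∷ w) (x ∷ u) (s≤s u<w) =
  trans (cong (does (a ≟ x) ∧_) (isPrefix-long w u u<w)) (∧-zeroʳ _)

occ-long : ∀ w u → length u < length w → occ w u ≡ 0
occ-long (a ∷ w) []      _   = refl
occ-long w       (x ∷ u) u<w =
  cong₂ (λ b n → 𝟙 b + n) (isPrefix-long w (x ∷ u) u<w) (occ-long w u (<-trans (n<1+n _) u<w))

-- Gap words and bispecial factors as lists.

gapWord : Bool → ℕ → List Bool
gapWord b n = b ∷ (replicate n false ∷ʳ true)

length-gapWord : ∀ b n → length (gapWord b n) ≡ 2 + n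
length-gapWord b n =
  cong suc (trans (length-++ (replicate n false)) (trans (cong (_+ 1) (length-replicate n)) (+-comm n 1)))

isPrefix-zeros : ∀ n i L → n < L →
  isPrefix (replicate n false ∷ʳ true) (factorAt i L) ≡ zeros n i ∧ cantor (n + i)
isPrefix-zeros zero i (suc L) _ with cantor i
... | true  = refl
... | false = refl
isPrefix-zeros (suc n) i (suc L) (s≤s n<L)
  rewrite isPrefix-zeros n (suc i) L n<L | +-suc n i with cantor i
... | true  = refl
... | false = refl

-- A word of length n + 2 has exactly d possible starts in a factor of length d + (n + 1).
occ-gapWord : ∀ b n d s → occ (gapWord b n) (factorAt s (d + suc n)) ≡ countGaps b n d s
occ-gapWord b n zero s =
  occ-long (gapWord b n) (factorAt s (suc n))
    (≤-reflexive (trans (cong suc (length-factorAt s (suc n))) (sym (length-gapWord b n))))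
occ-gapWord b n (suc d) s =
  cong₂ (λ x y → 𝟙 (does (b ≟ cantor s) ∧ x) + y)
    (isPrefix-zeros n (suc s) (d + suc n) (m≤n+m (suc n) d)) (occ-gapWord b n d (suc s))

-- By `bispecial-zero` there is no one in w; then 1w1 is a gap between consecutive ones, and
-- `gap-scale` gives its length.
bispecial-scale : ∀ w → (∀ a b → ∃[ i ] a ∷ (w ∷ʳ b) ≡ factorAt i (length (a ∷ (w ∷ʳ b)))) →
  ∃[ m ] w ≡ replicate (scale m) false
bispecial-scale w ext = m , trans w≡0 (cong (λ n → replicate n false) ℓ≡)
  where
  ℓ = length w
  i : Bool → Bool → ℕ
  i a b = proj₁ (ext a b)
  l : ∀ a b → cantor (i a b) ≡ a
  l a b = sym (∷-injectiveˡ (proj₂ (ext a b)))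
  w≡ : ∀ a b → w ≡ factorAt (suc (i a b)) ℓ
  w≡ a b = proj₁ (snoc-factorAt w b (suc (i a b)) (∷-injectiveʳ (proj₂ (ext a b))))
  r : ∀ a b → cantor (ℓ + suc (i a b)) ≡ b
  r a b = proj₂ (snoc-factorAt w b (suc (i a b)) (∷-injectiveʳ (proj₂ (ext a b))))
  z : ∀ j → j < ℓ → cantor (j + suc (i true true)) ≡ false
  z j j<ℓ with cantor (j + suc (i true true)) in cj
  ... | false = refl
  ... | true  = ⊥-elim (bispecial-zero ℓ ℓ i ≤-refl l
    (λ a b → factorAt⇒Agree _ _ ℓ (trans (sym (w≡ true true)) (w≡ a b))) r j j<ℓ cj)
  w≡0 : w ≡ replicate ℓ false
  w≡0 = trans (w≡ true true) (zeros⇒factorAt ℓ _ z)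
  g = gap-scale ℓ ℓ (i true true) ≤-refl (l true true) z (r true true)
  m = proj₁ g
  ℓ≡ : ℓ ≡ scale m
  ℓ≡ = proj₂ g

-- Equal margins leave a difference of the form ±δ with alternating signs, and one equal entry makes
-- δ zero.
square-rigid : (x y : Bool → Bool → ℕ) →
  (∀ a → x a false + x a true ≡ y a false + y a true) →
  (∀ b → x false b + x true b ≡ y false b + y true b) →
  ∀ a₀ b₀ → x a₀ b₀ ≡ y a₀ b₀ → ∀ a b → x a b ≡ y a b
square-rigid x y rows cols a₀ b₀ e a b = row a (col b₀ e a) b
  where
  cancelˡ : ∀ {p q p′ q′} → p + q ≡ p′ + q′ → p ≡ p′ → q ≡ q′
  cancelˡ {p} s refl = +-cancelˡ-≡ p _ _ s
  cancelʳ : ∀ {p q p′ q′} → p + q ≡ p′ + q′ → q ≡ q′ → p ≡ p′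
  cancelʳ {q = q} s refl = +-cancelʳ-≡ q _ _ s
  col : ∀ b {a₁} → x a₁ b ≡ y a₁ b → ∀ a → x a b ≡ y a b
  col b {false} e false = e
  col b {true}  e true  = e
  col b {false} e true  = cancelˡ (cols b) e
  col b {true}  e false = cancelʳ (cols b) e
  row : ∀ a {b₁} → x a b₁ ≡ y a b₁ → ∀ b → x a b ≡ y a b
  row a {false} e false = e
  row a {true}  e true  = e
  row a {false} e true  = cancelˡ (rows a) e
  row a {true}  e false = cancelʳ (rows a) e

-- Comparing two factors of equal length.

module Comparison
  (k s s′ L : ℕ)
  (pref≡ : pref k (factorAt s L) ≡ pref k (factorAt s′ L))
  (suff≡ : suff k (factorAt s L) ≡ suff k (factorAt s′ L))
  where

  u v : List Bool
  u = factorAt s L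
  v = factorAt s′ L

  isPrefix≡ : ∀ y → length y ≤ k → isPrefix y u ≡ isPrefix y v
  isPrefix≡ y y≤k =
    trans (sym (isPrefix-take y k u y≤k)) (trans (cong (isPrefix y) pref≡) (isPrefix-take y k v y≤k))

  suffixes≡ : ∀ y → length y ≤ k → suffixes y u ≡ suffixes y v
  suffixes≡ y y≤k =
    trans (sym (suffixes-suff y k u y≤k)) (trans (cong (suffixes y) suff≡) (suffixes-suff y k v y≤k))

  pref-agree : ∀ n → n ≤ k → n ≤ L → Agree s s′ n
  pref-agree n n≤k n≤L = factorAt⇒Agree s s′ n
    (trans (sym (pref-pref s)) (trans (cong (take n) pref≡) (pref-pref s′)))
    where
    pref-pref : ∀ s → take n (take k (factorAt s L)) ≡ factorAt s n
    pref-pref s = trans (take-take n k (factorAt s L))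
      (trans (cong (λ x → take x (factorAt s L)) (m≤n⇒m⊓n≡m n≤k)) (take-factorAt n s L n≤L))

  extendʳ≡ : ∀ y → length y ≤ k → occ y u ≡ occ y v →
    occ (y ∷ʳ false) u + occ (y ∷ʳ true) u ≡ occ (y ∷ʳ false) v + occ (y ∷ʳ true) v
  extendʳ≡ y y≤k e = +-cancelʳ-≡ (suffixes y u) _ _
    (trans (sym (occ-extendʳ y u)) (trans e (trans (occ-extendʳ y v)
      (cong (occ (y ∷ʳ false) v + occ (y ∷ʳ true) v +_) (sym (suffixes≡ y y≤k))))))

  extendˡ≡ : ∀ y → length y ≤ k → occ y u ≡ occ y v →
    occ (false ∷ y) u + occ (true ∷ y) u ≡ occ (false ∷ y) v + occ (true ∷ y) v
  extendˡ≡ y y≤k e = +-cancelʳ-≡ (𝟙 (isPrefix y u)) _ _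
    (trans (sym (occ-extendˡ y u)) (trans e (trans (occ-extendˡ y v)
      (cong (λ b → occ (false ∷ y) v + occ (true ∷ y) v + 𝟙 b) (sym (isPrefix≡ y y≤k))))))

  suff-agree : ∀ d n → d + n ≡ L → n ≤ k → Agree (d + s) (d + s′) n
  suff-agree d n refl n≤k = factorAt⇒Agree (d + s) (d + s′) n
    (trans (sym (drop-drop-suff s)) (trans (cong (drop (d ∸ (L ∸ k))) drop≡) (drop-drop-suff s′)))
    where
    drop≡ : drop (L ∸ k) u ≡ drop (L ∸ k) v
    drop≡ = subst₂ (λ x y → drop (x ∸ k) u ≡ drop (y ∸ k) v) (length-factorAt s L) (length-factorAt s′ L) suff≡
    L∸k≤d : L ∸ k ≤ d
    L∸k≤d = ≤-trans (∸-monoʳ-≤ L n≤k) (≤-reflexive (m+n∸n≡m d n))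
    drop-drop-suff : ∀ s → drop (d ∸ (L ∸ k)) (drop (L ∸ k) (factorAt s L)) ≡ factorAt (d + s) n
    drop-drop-suff s = trans (drop-drop (L ∸ k) (d ∸ (L ∸ k)) (factorAt s L))
      (trans (cong (λ x → drop x (factorAt s L)) (m+[n∸m]≡n L∸k≤d)) (drop-factorAt d s n))

  -- As n + 1 ≤ k for n = 3^m, prefix and suffix show the windows that govern the two end states,
  -- and the count of 0^n1 fixes the sum of those of 00^n1 and 10^n1. Factors shorter than n + 1
  -- contain neither.
  gapWord≡ : ∀ m → suc (scale m) ≤ k →
    occ (replicate (scale m) false ∷ʳ true) u ≡ occ (replicate (scale m) false ∷ʳ true) v →
    occ (gapWord true (scale m)) u ≡ occ (gapWord true (scale m)) v
  gapWord≡ m n<k e with suc (scale m) ≤? L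
  ... | no L≤n = trans (absent s) (sym (absent s′))
    where
    absent : ∀ s → occ (gapWord true (scale m)) (factorAt s L) ≡ 0
    absent s = occ-long _ (factorAt s L)
      (subst₂ _<_ (sym (length-factorAt s L)) (sym (length-gapWord true (scale m))) (m<n⇒m<1+n (≰⇒> L≤n)))
  ... | yes n<L = trans (occ≡countGaps true s) (trans
      (countGaps-agree m d s s′ (pref-agree _ n<k n<L) (suff-agree d _ d+n≡L n<k)
        (subst₂ _≡_ (cong₂ _+_ (occ≡countGaps false s) (occ≡countGaps true s))
                    (cong₂ _+_ (occ≡countGaps false s′) (occ≡countGaps true s′))
                    (extendˡ≡ _ (subst (_≤ k) (sym (suc-injective (length-gapWord true (scale m)))) n<k) e)))
      (sym (occ≡countGaps true s′)))
    where
    -- The starts counted run from s up to d + s, and the n + 1 letters from d + s on are exactly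
    -- the suffix.
    d = L ∸ suc (scale m)
    d+n≡L : d + suc (scale m) ≡ L
    d+n≡L = m∸n+n≡m n<L
    occ≡countGaps : ∀ b s → occ (gapWord b (scale m)) (factorAt s L) ≡ countGaps b (scale m) d s
    occ≡countGaps b s = trans (cong (λ l → occ (gapWord b (scale m)) (factorAt s l)) (sym d+n≡L))
      (occ-gapWord b (scale m) d s)

  occ≡⊎factor : ∀ w → occ w u ≡ occ w v ⊎ ∃[ i ] w ≡ factorAt i (length w)
  occ≡⊎factor w with occ-factorAt w s L | occ-factorAt w s′ L
  ... | inj₁ e | inj₁ e′ = inj₁ (trans e (sym e′))
  ... | inj₂ f | _       = inj₂ f
  ... | inj₁ _ | inj₂ f  = inj₂ f

  -- An extension absent from u and v has count 0 in both. Otherwise all four are factors of the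
  -- sequence, y is 0^(3^m), and 1y1 is settled by `gapWord≡`.
  one-extension≡ : ∀ y → suc (length y) ≤ k → (∀ w → length w ≡ suc (length y) → occ w u ≡ occ w v) →
    ∃[ a ] ∃[ b ] occ (a ∷ (y ∷ʳ b)) u ≡ occ (a ∷ (y ∷ʳ b)) v
  one-extension≡ y y<k shorter
    with occ≡⊎factor (false ∷ (y ∷ʳ false)) | occ≡⊎factor (false ∷ (y ∷ʳ true))
       | occ≡⊎factor (true ∷ (y ∷ʳ false)) | occ≡⊎factor (true ∷ (y ∷ʳ true))
  ... | inj₁ e | _ | _ | _ = false , false , e
  ... | _ | inj₁ e | _ | _ = false , true , e
  ... | _ | _ | inj₁ e | _ = true , false , e
  ... | _ | _ | _ | inj₁ e = true , true , e
  ... | inj₂ f₀₀ | inj₂ f₀₁ | inj₂ f₁₀ | inj₂ f₁₁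
    with bispecial-scale y (λ where
           false false → f₀₀
           false true  → f₀₁
           true  false → f₁₀
           true  true  → f₁₁)
  ... | m , refl = true , true , gapWord≡ m (subst (λ n → suc n ≤ k) (length-replicate (scale m)) y<k)
    (shorter _ (length-∷ʳ true y))

  extensions≡ : ∀ y → suc (length y) ≤ k → (∀ w → length w ≡ suc (length y) → occ w u ≡ occ w v) →
    ∀ a b → occ (a ∷ (y ∷ʳ b)) u ≡ occ (a ∷ (y ∷ʳ b)) v
  extensions≡ y y<k shorter with one-extension≡ y y<k shorter
  ... | a₀ , b₀ , e = square-rigid _ _
    (λ a → extendʳ≡ (a ∷ y) y<k (shorter _ refl))
    (λ b → extendˡ≡ (y ∷ʳ b) (subst (_≤ k) (sym (length-∷ʳ b y)) y<k) (shorter _ (length-∷ʳ b y)))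
    a₀ b₀ e

  Occ≡ : ℕ → Set
  Occ≡ n = ∀ w → length w ≡ n → occ w u ≡ occ w v

  -- A word of length n + 2 is ayb with y of length n, and the counts at length n + 1 supply the
  -- margins of the square for y.
  ascend : Occ≡ 1 → ∀ n → n ≤ k → Occ≡ (suc n)
  ascend letters zero    _   = letters
  ascend letters (suc n) n<k (a ∷ w) e with initLast w
  ... | y ∷ʳ′ b with suc-injective (trans (sym (length-∷ʳ b y)) (suc-injective e))
  ... | refl = extensions≡ y n<k (ascend letters n (<⇒≤ n<k)) a b

  descend : ∀ n → n ≤ k → Occ≡ (suc n) → Occ≡ 1
  descend zero    _   longest = longest
  descend (suc n) n<k longer  = descend n (<⇒≤ n<k) λ w e → trans (occ-extendʳ w u) (trans
    (cong₂ _+_ (cong₂ _+_ (longer _ (trans (length-∷ʳ false w) (cong suc e)))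
                          (longer _ (trans (length-∷ʳ true w) (cong suc e))))
               (suffixes≡ w (subst (_≤ k) (sym e) n<k)))
    (sym (occ-extendʳ w v)))

-- The equivalence.

factors-∼ : ∀ k s s′ L (u v : List Bool) → u ≡ factorAt s L → v ≡ factorAt s′ L →
  pref k u ≡ pref k v → suff k u ≡ suff k v → (u ∼[ suc k ] v) ⇔ (u ∼[ 1 ] v)
factors-∼ k s s′ L u v refl refl pref≡ suff≡ = mk⇔
  -- `pref 0` is empty by computation, but `suff 0` drops `length u` letters and needs an argument.
  (λ (_ , _ , occ≡) → refl , trans (drop-all _ u ≤-refl) (sym (drop-all _ v ≤-refl)) , descend k ≤-refl occ≡)
  (λ (_ , _ , occ≡) → pref≡ , suff≡ , ascend occ≡ k ≤-refl)
  where open Comparison k s s′ L pref≡ suff≡ using (ascend; descend)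

theorem1p2 : (k : ℕ) → k ≥ 1 → (u v : List Bool) →
    IsFactor u → IsFactor v → length u ≡ length v →
    pref k u ≡ pref k v → suff k u ≡ suff k v →
    (u ∼[ k + 1 ] v) ⇔ (u ∼[ 1 ] v)
theorem1p2 k _ u v (s , u≡) (s′ , v≡) |u|≡|v| pref≡ suff≡ =
  -- `suc k ∸ 1` reduces to k, while `k + 1 ∸ 1` is stuck.
  subst (λ n → (u ∼[ n ] v) ⇔ (u ∼[ 1 ] v)) (+-comm 1 k)
    (factors-∼ k s s′ (length v) u v (trans u≡ (cong (factorAt s) |u|≡|v|)) v≡ pref≡ suff≡)
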